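{- Let $n,m\ge 1$ and let $S_n^m = K_n\vee\overline{K_m}$ be the complete split graph. Then the frustration index of the all-negative complete split graph is \[ l(-S_n^m) = \begin{cases} \left\lfloor\frac{(n-1)^2}{4}+\frac{mn}{2}-\frac{m^2}{4}\right\rfloor & \text{if } n > m,\\[2pt] \frac{n(n-1)}{2} & \text{if } n\le m.\end{cases} \]
   Context: All graphs are finite, simple and undirected. A signed graph $\Sigma=(G,\sigma)$ is a graph $G$ with a signature $\sigma:E(G)\to\{+1,-1\}$. The sign of a cycle is the product of the signs of its edges; $\Sigma$ is balanced if all its cycles are positive. The frustration index $l(\Sigma)$ is the minimum number of edges whose deletion makes $\Sigma$ balanced. $-G$ is $G$ with all edges signed $-1$. $\overline{K_m}$ is the edgeless graph on $m$ vertices and $\vee$ denotes the join of vertex-disjoint graphs. -}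

module Defs where

open import Level using (0ℓ)
open import Data.Empty using (⊥)
open import Data.Unit using (⊤; tt)
open import Data.Nat using (ℕ; _+_; _≤_)
open import Data.Nat.Properties using (≤-antisym)
open import Data.Fin using (Fin; splitAt; _<_)
open import Data.Fin.Properties using (_≟_; _<?_)
open import Data.List using (List; []; _∷_; length; filter; allFin; cartesianProduct)
open import Data.List.Relation.Unary.Unique.Propositional using (Unique)
open import Data.Product using (_×_; _,_; proj₁; proj₂; ∃-syntax; uncurry)
open import Data.Sign using (Sign; _*_)
open import Data.Sum using (_⊎_; inj₁; inj₂)
open import Relation.Binary using (Rel; Symmetric; Irreflexive; Decidable; _⇒_)
open import Relation.Binary.Construct.Closure.ReflexiveTransitive using (Star; ε; _◅_)
open import Relation.Binary.PropositionalEquality using (_≡_; _≢_; refl; sym; ≢-sym)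
open import Relation.Nullary using (¬_; yes; no; _×-dec_; ¬?)

record Graph (n : ℕ) : Set₁ where
  field
    Adj    : Rel (Fin n) 0ℓ
    symm   : Symmetric Adj
    irrefl : Irreflexive _≡_ Adj
    adj?   : Decidable Adj

open Graph public

-- Each edge {u , v} is listed once, as the pair with u < v.
edges : ∀ {n} → Graph n → List (Fin n × Fin n)
edges {n} G = filter (uncurry λ u v → (u <? v) ×-dec adj? G u v)
                     (cartesianProduct (allFin n) (allFin n))

∣E_∣ : ∀ {n} → Graph n → ℕ
∣E G ∣ = length (edges G)

-- A set of edges of G is represented by the spanning subgraph it forms.
_⊆ᴱ_ : ∀ {n} → Graph n → Graph n → Set
H ⊆ᴱ G = Adj H ⇒ Adj G

_∖ᴳ_ : ∀ {n} → Graph n → Graph n → Graph n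
Adj    (G ∖ᴳ H) u v = Adj G u v × ¬ Adj H u v
symm   (G ∖ᴳ H) (g , ¬h) = symm G g , λ h → ¬h (symm H h)
irrefl (G ∖ᴳ H) eq (g , _) = irrefl G eq g
adj?   (G ∖ᴳ H) u v = adj? G u v ×-dec ¬? (adj? H u v)

K : ∀ n → Graph n
Adj    (K n) = _≢_
symm   (K n) = ≢-sym
irrefl (K n) eq u≢v = u≢v eq
adj?   (K n) u v = ¬? (u ≟ v)

edgeless : ∀ n → Graph n
Adj    (edgeless n) _ _ = ⊥
symm   (edgeless n) ()
irrefl (edgeless n) _ ()
adj?   (edgeless n) _ _ = no λ ()

module _ {m n : ℕ} (G : Graph m) (H : Graph n) where

  JoinAdj : Rel (Fin m ⊎ Fin n) 0ℓ
  JoinAdj (inj₁ u) (inj₁ v) = Adj G u v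
  JoinAdj (inj₂ u) (inj₂ v) = Adj H u v
  JoinAdj (inj₁ _) (inj₂ _) = ⊤
  JoinAdj (inj₂ _) (inj₁ _) = ⊤

  joinAdj-sym : Symmetric JoinAdj
  joinAdj-sym {inj₁ _} {inj₁ _} e = symm G e
  joinAdj-sym {inj₁ _} {inj₂ _} e = tt
  joinAdj-sym {inj₂ _} {inj₁ _} e = tt
  joinAdj-sym {inj₂ _} {inj₂ _} e = symm H e

  joinAdj-irrefl : Irreflexive _≡_ JoinAdj
  joinAdj-irrefl {inj₁ _} refl e = irrefl G refl e
  joinAdj-irrefl {inj₂ _} refl e = irrefl H refl e

  joinAdj? : Decidable JoinAdj
  joinAdj? (inj₁ u) (inj₁ v) = adj? G u v
  joinAdj? (inj₁ _) (inj₂ _) = yes tt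
  joinAdj? (inj₂ _) (inj₁ _) = yes tt
  joinAdj? (inj₂ u) (inj₂ v) = adj? H u v

-- The first m vertices carry G and the last n carry H.
_∨_ : ∀ {m n} → Graph m → Graph n → Graph (m + n)
Adj    (_∨_ {m} G H) u v = JoinAdj G H (splitAt m u) (splitAt m v)
symm   (_∨_ {m} G H) {u} {v} = joinAdj-sym G H {splitAt m u} {splitAt m v}
irrefl (_∨_ {m} G H) {u} refl = joinAdj-irrefl G H {splitAt m u} refl
adj?   (_∨_ {m} G H) u v = joinAdj? G H (splitAt m u) (splitAt m v)

completeSplit : ∀ n m → Graph (n + m)
completeSplit n m = K n ∨ edgeless m

record SignedGraph (n : ℕ) : Set₁ where
  field
    graph : Graph n
    σ     : ∀ {u v} → Adj graph u v → Sign
    -- Makes σ a function of the unordered pair {u , v}: using it twice shows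
    -- that σ does not depend on the adjacency proof either.
    σ-sym : ∀ {u v} (e : Adj graph u v) (e′ : Adj graph v u) → σ e ≡ σ e′

open SignedGraph public

-_ : ∀ {n} → Graph n → SignedGraph n
graph (- G) = G
σ     (- G) _ = Sign.-
σ-sym (- G) _ _ = refl

_∖_ : ∀ {n} → SignedGraph n → Graph n → SignedGraph n
graph (Σ ∖ H) = graph Σ ∖ᴳ H
σ     (Σ ∖ H) (e , _) = σ Σ e
σ-sym (Σ ∖ H) (e , _) (e′ , _) = σ-sym Σ e e′

Walk : ∀ {n} → Graph n → Rel (Fin n) 0ℓ
Walk G = Star (Adj G)

vertices : ∀ {n} (G : Graph n) {u v} → Walk G u v → List (Fin n)
vertices G {u} ε       = u ∷ []
vertices G {u} (_ ◅ p) = u ∷ vertices G p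

-- A path on at least three distinct vertices together with an edge joining
-- its ends.
record Cycle {n} (G : Graph n) : Set where
  field
    {start end} : Fin n
    path        : Walk G start end
    distinct    : Unique (vertices G path)
    long        : 3 ≤ length (vertices G path)
    closing     : Adj G end start

walkSign : ∀ {n} (Σ : SignedGraph n) {u v} → Walk (graph Σ) u v → Sign
walkSign Σ ε       = Sign.+
walkSign Σ (e ◅ p) = σ Σ e * walkSign Σ p

cycleSign : ∀ {n} (Σ : SignedGraph n) → Cycle (graph Σ) → Sign
cycleSign Σ C = walkSign Σ path * σ Σ closing
  where open Cycle C

Balanced : ∀ {n} → SignedGraph n → Set
Balanced Σ = (C : Cycle (graph Σ)) → cycleSign Σ C ≡ Sign.+

-- l is the minimum of ∣E H ∣ over the edge sets H whose deletion balances Σ.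
IsFrustrationIndex : ∀ {n} → SignedGraph n → ℕ → Set₁
IsFrustrationIndex Σ l =
  (∃[ H ] H ⊆ᴱ graph Σ × Balanced (Σ ∖ H) × ∣E H ∣ ≡ l) ×
  (∀ H → H ⊆ᴱ graph Σ → Balanced (Σ ∖ H) → l ≤ ∣E H ∣)

frustrationIndex-unique : ∀ {n} (Σ : SignedGraph n) {k l} →
  IsFrustrationIndex Σ k → IsFrustrationIndex Σ l → k ≡ l
frustrationIndex-unique Σ ((H , H⊆ , bal , refl) , min) ((H′ , H′⊆ , bal′ , refl) , min′) =
  ≤-antisym (min H′ H′⊆ bal′) (min′ H H⊆ bal)

-- Deleting H balances the all-negative graph exactly when what is kept is bipartite, so one
-- has to maximise the number of kept edges. For the upper bound only triangle-freeness
-- matters: a kept edge ab inside the clique has at most one kept edge to each other vertex, so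
-- removing a and b costs at most 1 + (n - 2) + m edges (Mantel's argument); once the clique
-- has no kept edges at most n m remain. The bound is attained by the cut with a clique
-- vertices and all independent vertices on one side and the other b = n - a clique vertices
-- opposite, where a is (n - m) / 2 rounded up (and 0 if n ≤ m).
module Submission where

open import Defs
open import Data.Nat using (ℕ; _≤_; _>_; _<_; zero; suc; _+_; _*_; z≤n; s≤s; s≤s⁻¹)
open import Data.Nat.Properties
open import Algebra.Properties.CommutativeSemigroup +-commutativeSemigroup using (interchange)
open import Data.Nat.Tactic.RingSolver using (solve-∀)
open import Data.Nat.ListAction using (sum)
open import Data.Nat.ListAction.Properties using (sum-++; sum-↭)
import Data.Nat.DivMod as ℕ
open import Data.Nat.Divisibility using (divides-refl)
open import Data.Integer as ℤ using (+_; 1ℤ)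
import Data.Integer.Properties as ℤ
import Data.Integer.Tactic.RingSolver as ℤSolver
open import Data.Rational.Unnormalised as ℚ using (_/_; _≃_; floor; *≡*)
open import Data.Product using (_×_; ∃-syntax; _,_; uncurry; proj₁; proj₂)
open import Data.Sum using (_⊎_; inj₁; inj₂; [_,_]′)
open import Data.Bool using (if_then_else_; true; false)
open import Data.Fin as Fin using (Fin; _↑ˡ_; _↑ʳ_; splitAt)
import Data.Fin.Properties as Fin
open import Data.Sign as Sign using (Sign)
import Data.Sign.Properties as Sign
open import Data.List using (List; []; _∷_; _++_; length; map; filter; allFin; tabulate; cartesianProduct)
open import Data.List.Properties using (map-++; map-∘; length-tabulate)
open import Data.List.Membership.Propositional.Properties using (∈-∃++)
open import Data.List.Membership.Propositional using (find)
open import Data.List.Relation.Unary.All as All using (All; []; _∷_)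
open import Data.List.Relation.Unary.All.Properties using (¬Any⇒All¬) renaming (tabulate⁺ to All-tabulate⁺)
open import Data.List.Relation.Unary.Any using (any?)
open import Data.List.Relation.Unary.AllPairs using (AllPairs; []; _∷_)
open import Data.List.Relation.Unary.AllPairs.Properties using (tabulate⁺; tabulate⁺-<)
open import Data.List.Relation.Binary.Permutation.Propositional using (_↭_; ↭-refl; ↭-prep; ↭-swap; ↭-trans; ↭-reflexive)
import Data.List.Relation.Binary.Permutation.Propositional as ↭
open import Data.List.Relation.Binary.Permutation.Propositional.Properties using (shift; ↭-length) renaming (map⁺ to ↭-map⁺)
open import Function using (_∘_; id; const)
open import Relation.Nullary using (¬_; Dec; yes; no; does; contradiction; _×-dec_)
open import Relation.Nullary.Decidable using (dec-true; dec-false; toSum)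
open import Relation.Unary using (Pred; Decidable)
open import Relation.Binary.Construct.Closure.ReflexiveTransitive using (ε; _◅_)
open import Relation.Binary.PropositionalEquality

private
  variable
    A B C : Set
    N : ℕ

-- Sums and counting

∑ : List A → (A → ℕ) → ℕ
∑ xs f = sum (map f xs)

∑-cong : ∀ {f g : A → ℕ} {xs} → All (λ x → f x ≡ g x) xs → ∑ xs f ≡ ∑ xs g
∑-cong []       = refl
∑-cong (p ∷ ps) = cong₂ _+_ p (∑-cong ps)

∑-++ : ∀ (f : A → ℕ) xs ys → ∑ (xs ++ ys) f ≡ ∑ xs f + ∑ ys f
∑-++ f xs ys = trans (cong sum (map-++ f xs ys)) (sum-++ (map f xs) (map f ys))

∑-map : ∀ (f : B → ℕ) (g : A → B) xs → ∑ (map g xs) f ≡ ∑ xs (f ∘ g)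
∑-map f g xs = cong sum (sym (map-∘ xs))

∑-↭ : ∀ (f : A → ℕ) {xs ys} → xs ↭ ys → ∑ xs f ≡ ∑ ys f
∑-↭ f p = sum-↭ (↭-map⁺ f p)

∑-+ : ∀ (f g : A → ℕ) xs → ∑ xs (λ x → f x + g x) ≡ ∑ xs f + ∑ xs g
∑-+ f g []       = refl
∑-+ f g (x ∷ xs) rewrite ∑-+ f g xs = interchange (f x) (g x) (∑ xs f) (∑ xs g)

∑-const : ∀ {f : A → ℕ} {k xs} → All (λ x → f x ≡ k) xs → ∑ xs f ≡ length xs * k
∑-const []       = refl
∑-const (p ∷ ps) = cong₂ _+_ p (∑-const ps)

∑-≤ : ∀ {f : A → ℕ} {k} xs → (∀ x → f x ≤ k) → ∑ xs f ≤ length xs * k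
∑-≤ []       f≤k = z≤n
∑-≤ (x ∷ xs) f≤k = +-mono-≤ (f≤k x) (∑-≤ xs f≤k)

∑-cartesianProduct : ∀ (f : A × B → ℕ) xs ys →
  ∑ (cartesianProduct xs ys) f ≡ ∑ xs (λ x → ∑ ys (λ y → f (x , y)))
∑-cartesianProduct f []       ys = refl
∑-cartesianProduct f (x ∷ xs) ys =
  trans (∑-++ f (map (x ,_) ys) _)
        (cong₂ _+_ (∑-map f (x ,_) ys) (∑-cartesianProduct f xs ys))

𝟙 : Dec A → ℕ
𝟙 a? = if does a? then 1 else 0

𝟙-yes : (a? : Dec A) → A → 𝟙 a? ≡ 1
𝟙-yes a? a rewrite dec-true a? a = refl

𝟙-no : (a? : Dec A) → ¬ A → 𝟙 a? ≡ 0
𝟙-no a? ¬a rewrite dec-false a? ¬a = refl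

𝟙-cong : (a? : Dec A) (b? : Dec B) → (A → B) → (B → A) → 𝟙 a? ≡ 𝟙 b?
𝟙-cong (yes a) b? f g = sym (𝟙-yes b? (f a))
𝟙-cong (no ¬a) b? f g = sym (𝟙-no b? (¬a ∘ g))

𝟙-⊎ : (a? : Dec A) (b? : Dec B) (c? : Dec C) → (A → B ⊎ C) → (B → A) → (C → A) → ¬ (B × C) →
      𝟙 a? ≡ 𝟙 b? + 𝟙 c?
𝟙-⊎ a? (yes b) (yes c) f g h disj = contradiction (b , c) disj
𝟙-⊎ a? (yes b) (no ¬c) f g h disj = 𝟙-yes a? (g b)
𝟙-⊎ a? (no ¬b) (yes c) f g h disj = 𝟙-yes a? (h c)
𝟙-⊎ a? (no ¬b) (no ¬c) f g h disj = 𝟙-no a? ([ ¬b , ¬c ]′ ∘ f)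

𝟙≤1 : (a? : Dec A) → 𝟙 a? ≤ 1
𝟙≤1 (yes _) = ≤-refl
𝟙≤1 (no _)  = z≤n

𝟙+𝟙≤1 : (a? : Dec A) (b? : Dec B) → ¬ (A × B) → 𝟙 a? + 𝟙 b? ≤ 1
𝟙+𝟙≤1 (yes a) b? disj = ≤-reflexive (cong suc (𝟙-no b? (λ b → disj (a , b))))
𝟙+𝟙≤1 (no _)  b? disj = 𝟙≤1 b?

length-filter : ∀ {P : Pred A _} (P? : Decidable P) xs → length (filter P? xs) ≡ ∑ xs (𝟙 ∘ P?)
length-filter P? []       = refl
length-filter P? (x ∷ xs) with does (P? x)
... | true  = cong suc (length-filter P? xs)
... | false = length-filter P? xs

-- Edge counts along lists of vertices

degree : Graph N → List (Fin N) → Fin N → ℕ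
degree G ys x = ∑ ys (λ y → 𝟙 (adj? G x y))

between : Graph N → List (Fin N) → List (Fin N) → ℕ
between G xs ys = ∑ xs (degree G ys)

-- Each pair is counted from whichever vertex comes first in the list, not from the smaller one. The
-- count does not depend on the order of the list, so Mantel's argument may move the ends of an edge
-- to the front.
induced : Graph N → List (Fin N) → ℕ
induced G []       = 0
induced G (x ∷ xs) = degree G xs x + induced G xs

orderedPair? : (G : Graph N) (u v : Fin N) → Dec (u Fin.< v × Adj G u v)
orderedPair? G u v = (u Fin.<? v) ×-dec adj? G u v

-- In an increasing list the condition `u < v` holds along the rest of the head's row and fails
-- along its column and on the diagonal, which leaves exactly the pairs counted by `induced`.
∑-orderedPair : ∀ (G : Graph N) {xs} → AllPairs Fin._<_ xs →
  ∑ xs (λ u → ∑ xs (λ v → 𝟙 (orderedPair? G u v))) ≡ induced G xs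
∑-orderedPair G [] = refl
∑-orderedPair G {x ∷ xs} (x< ∷ xs<) =
  cong₂ _+_
    (cong₂ _+_ (𝟙-no (orderedPair? G x x) (Fin.<-irrefl refl ∘ proj₁))
      (∑-cong (All.map (λ {v} x<v → 𝟙-cong (orderedPair? G x v) (adj? G x v) proj₂ (x<v ,_)) x<)))
    (trans
      (∑-cong (All.map (λ {u} x<u → cong (_+ ∑ xs (λ v → 𝟙 (orderedPair? G u v)))
        (𝟙-no (orderedPair? G u x) (Fin.<-asym x<u ∘ proj₁))) x<))
      (∑-orderedPair G xs<))

∣E∣≡induced : (G : Graph N) → ∣E G ∣ ≡ induced G (allFin N)
∣E∣≡induced {N} G = begin
  ∣E G ∣
    ≡⟨ length-filter (uncurry (orderedPair? G)) (cartesianProduct (allFin N) (allFin N)) ⟩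
  ∑ (cartesianProduct (allFin N) (allFin N)) (𝟙 ∘ uncurry (orderedPair? G))
    ≡⟨ ∑-cartesianProduct (𝟙 ∘ uncurry (orderedPair? G)) (allFin N) (allFin N) ⟩
  ∑ (allFin N) (λ u → ∑ (allFin N) (λ v → 𝟙 (orderedPair? G u v)))
    ≡⟨ ∑-orderedPair G (tabulate⁺-< id) ⟩
  induced G (allFin N) ∎
  where open ≡-Reasoning

induced-∖ᴳ : ∀ (G H : Graph N) → H ⊆ᴱ G → ∀ xs →
  induced G xs ≡ induced H xs + induced (G ∖ᴳ H) xs
induced-∖ᴳ G H H⊆G []       = refl
induced-∖ᴳ G H H⊆G (x ∷ xs) = begin
  degree G xs x + induced G xs
    ≡⟨ cong₂ _+_ (trans (∑-cong (All.universal split xs)) (∑-+ _ _ xs)) (induced-∖ᴳ G H H⊆G xs) ⟩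
  (degree H xs x + degree (G ∖ᴳ H) xs x) + (induced H xs + induced (G ∖ᴳ H) xs)
    ≡⟨ interchange (degree H xs x) (degree (G ∖ᴳ H) xs x) (induced H xs) (induced (G ∖ᴳ H) xs) ⟩
  (degree H xs x + induced H xs) + (degree (G ∖ᴳ H) xs x + induced (G ∖ᴳ H) xs) ∎
  where
  open ≡-Reasoning
  split : ∀ y → 𝟙 (adj? G x y) ≡ 𝟙 (adj? H x y) + 𝟙 (adj? (G ∖ᴳ H) x y)
  split y = 𝟙-⊎ (adj? G x y) (adj? H x y) (adj? (G ∖ᴳ H) x y)
    (λ g → [ inj₁ , (λ ¬h → inj₂ (g , ¬h)) ]′ (toSum (adj? H x y)))
    H⊆G proj₁ (λ (h , _ , ¬h) → ¬h h)

-- Deleted and kept edges add up to a fixed total, so minimising the former is maximising the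
-- latter.
∣E∣-∖ᴳ : ∀ (G H : Graph N) → H ⊆ᴱ G → ∣E G ∣ ≡ ∣E H ∣ + ∣E G ∖ᴳ H ∣
∣E∣-∖ᴳ {N} G H H⊆G
  rewrite ∣E∣≡induced G | ∣E∣≡induced H | ∣E∣≡induced (G ∖ᴳ H) = induced-∖ᴳ G H H⊆G (allFin N)

between-++ˡ : ∀ (G : Graph N) xs ys zs →
  between G (xs ++ ys) zs ≡ between G xs zs + between G ys zs
between-++ˡ G xs ys zs = ∑-++ (degree G zs) xs ys

induced-++ : ∀ (G : Graph N) xs ys →
  induced G (xs ++ ys) ≡ induced G xs + between G xs ys + induced G ys
induced-++ G []       ys = refl
induced-++ G (x ∷ xs) ys
  rewrite induced-++ G xs ys | ∑-++ (λ y → 𝟙 (adj? G x y)) xs ys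
  = rearrange (degree G xs x) (degree G ys x) (induced G xs) (between G xs ys) (induced G ys)
  where
  rearrange : ∀ a b c d e → a + b + (c + d + e) ≡ a + c + (b + d) + e
  rearrange = solve-∀

induced-↭ : ∀ (G : Graph N) {xs ys} → xs ↭ ys → induced G xs ≡ induced G ys
induced-↭ G ↭.refl        = refl
induced-↭ G (↭.prep x p)  = cong₂ _+_ (∑-↭ _ p) (induced-↭ G p)
induced-↭ G {_ ∷ _ ∷ xs} {_ ∷ _ ∷ ys} (↭.swap x y p)
  -- The pair formed by the two leading vertices is now counted from its other end, so symmetry of
  -- adjacency enters here.
  rewrite 𝟙-cong (adj? G x y) (adj? G y x) (symm G) (symm G)
        | ∑-↭ (λ z → 𝟙 (adj? G x z)) p | ∑-↭ (λ z → 𝟙 (adj? G y z)) p | induced-↭ G p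
  = interchange (𝟙 (adj? G y x)) (degree G ys x) (degree G ys y) (induced G ys)
induced-↭ G (↭.trans p q) = trans (induced-↭ G p) (induced-↭ G q)

induced-independent : ∀ (G : Graph N) {xs} → AllPairs (λ u v → ¬ Adj G u v) xs → induced G xs ≡ 0
induced-independent G [] = refl
induced-independent G {x ∷ xs} (x≁ ∷ xs≁) = cong₂ _+_
  (trans (∑-const (All.map (𝟙-no (adj? G x _)) x≁)) (*-zeroʳ (length xs)))
  (induced-independent G xs≁)

-- The count n(n - 1)/2, doubled to avoid halving and rearranged to avoid subtraction. A new vertex
-- joined to all `l` others raises both sides by 2l + 1.
induced-clique : ∀ (G : Graph N) {xs} → AllPairs (Adj G) xs →
  2 * induced G xs + length xs ≡ length xs * length xs
induced-clique G [] = refl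
induced-clique G {x ∷ xs} (x~ ∷ xs~)
  rewrite ∑-const {f = λ y → 𝟙 (adj? G x y)} (All.map (𝟙-yes (adj? G x _)) x~)
  = begin
  2 * (l * 1 + e) + suc l       ≡⟨ rearrange l e ⟩
  (2 * e + l) + suc (l + l)     ≡⟨ cong (_+ suc (l + l)) (induced-clique G xs~) ⟩
  l * l + suc (l + l)           ≡⟨ square l ⟩
  suc l * suc l                 ∎
  where
  open ≡-Reasoning
  l = length xs
  e = induced G xs
  rearrange : ∀ l e → 2 * (l * 1 + e) + suc l ≡ (2 * e + l) + suc (l + l)
  rearrange = solve-∀
  square : ∀ l → l * l + suc (l + l) ≡ suc l * suc l
  square = solve-∀

between-full : ∀ (G : Graph N) {p q} (f : Fin p → Fin N) (g : Fin q → Fin N) →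
  (∀ i j → Adj G (f i) (g j)) → between G (tabulate f) (tabulate g) ≡ p * q
between-full G {p} {q} f g adj = begin
  between G (tabulate f) (tabulate g)
    ≡⟨ ∑-const (All-tabulate⁺ λ i → ∑-const (All-tabulate⁺ λ j → 𝟙-yes (adj? G _ _) (adj i j))) ⟩
  length (tabulate f) * (length (tabulate g) * 1)
    ≡⟨ cong₂ _*_ (length-tabulate f) (trans (*-identityʳ _) (length-tabulate g)) ⟩
  p * q ∎
  where open ≡-Reasoning

between-none : ∀ (G : Graph N) {p q} (f : Fin p → Fin N) (g : Fin q → Fin N) →
  (∀ i j → ¬ Adj G (f i) (g j)) → between G (tabulate f) (tabulate g) ≡ 0
between-none G f g ¬adj =
  trans (∑-const {k = 0} (All-tabulate⁺ λ i → trans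
          (∑-const (All-tabulate⁺ λ j → 𝟙-no (adj? G _ _) (¬adj i j)))
          (*-zeroʳ (length (tabulate g)))))
        (*-zeroʳ (length (tabulate f)))

tabulate-+ : ∀ p {q} (f : Fin (p + q) → A) →
  tabulate f ≡ tabulate (f ∘ (_↑ˡ q)) ++ tabulate (f ∘ (p ↑ʳ_))
tabulate-+ zero    f = refl
tabulate-+ (suc p) f = cong (f Fin.zero ∷_) (tabulate-+ p (f ∘ Fin.suc))

-- Mantel's argument

TriangleFree : Graph N → Set
TriangleFree G = ∀ {a b c} → Adj G a b → Adj G a c → ¬ Adj G b c

module Mantel (G : Graph N) (triangleFree : TriangleFree G) where

  -- A common neighbour of `a` and `b` would complete a triangle, so each `z` contributes at most 1.
  degree+degree≤ : ∀ {a b} → Adj G a b → ∀ zs → degree G zs a + degree G zs b ≤ length zs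
  degree+degree≤ {a} {b} a~b zs = begin
    degree G zs a + degree G zs b                 ≡⟨ ∑-+ _ _ zs ⟨
    ∑ zs (λ z → 𝟙 (adj? G a z) + 𝟙 (adj? G b z))
      ≤⟨ ∑-≤ zs (λ z → 𝟙+𝟙≤1 (adj? G a z) (adj? G b z) (uncurry (triangleFree a~b))) ⟩
    length zs * 1                                 ≡⟨ *-identityʳ _ ⟩
    length zs                                     ∎
    where open ≤-Reasoning

  -- Either the head has a neighbour in the tail, or an edge found in the tail is carried past the
  -- head, or the head adds nothing to a count that is already 0.
  edge-or-independent : ∀ xs → induced G xs ≡ 0 ⊎
    ∃[ a ] ∃[ b ] ∃[ zs ] Adj G a b × xs ↭ a ∷ b ∷ zs
  edge-or-independent [] = inj₁ refl
  edge-or-independent (x ∷ xs) with any? (adj? G x) xs | edge-or-independent xs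
  ... | yes x~ | _ =
    let b , b∈xs , x~b = find x~
        us , vs , xs≡  = ∈-∃++ b∈xs
    in inj₂ (x , b , us ++ vs , x~b , ↭-prep x (↭-trans (↭-reflexive xs≡) (shift b us vs)))
  ... | no _ | inj₂ (a , b , zs , a~b , p) = inj₂ (a , b , x ∷ zs , a~b ,
    ↭-trans (↭-prep x p) (↭-trans (↭-swap x a ↭-refl) (↭-prep a (↭-swap x b ↭-refl))))
  ... | no ¬x~ | inj₁ eq = inj₁ (cong₂ _+_
    (trans (∑-const (All.map (𝟙-no (adj? G x _)) (¬Any⇒All¬ xs ¬x~))) (*-zeroʳ (length xs))) eq)

  module _ (ys : List (Fin N)) where

    -- With the clique as `xs` and the independent vertices as `ys`, this counts all kept edges.
    -- Only `xs` shrinks during the induction; `ys` stays fixed.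
    touching : List (Fin N) → ℕ
    touching xs = induced G xs + between G xs ys

    -- The edge ab itself accounts for 1, and each vertex of `zs` and of `ys` for at most one edge
    -- to `a` or `b`.
    remove-edge : ∀ {a b} zs → Adj G a b →
      touching (a ∷ b ∷ zs) ≤ 1 + length zs + length ys + touching zs
    remove-edge {a} {b} zs a~b = begin
      touching (a ∷ b ∷ zs)
        ≡⟨ rearrange (𝟙 (adj? G a b)) (degree G zs a) (degree G zs b) (induced G zs)
                     (degree G ys a) (degree G ys b) (between G zs ys) ⟩
      𝟙 (adj? G a b) + (degree G zs a + degree G zs b) + (degree G ys a + degree G ys b) + touching zs
        ≤⟨ +-monoˡ-≤ (touching zs) (+-mono-≤
             (+-mono-≤ (𝟙≤1 (adj? G a b)) (degree+degree≤ a~b zs)) (degree+degree≤ a~b ys)) ⟩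
      1 + length zs + length ys + touching zs ∎
      where
      open ≤-Reasoning
      rearrange : ∀ i az bz e ay by t →
        i + az + (bz + e) + (ay + (by + t)) ≡ i + (az + bz) + (ay + by) + (e + t)
      rearrange = solve-∀

    -- The induction shared by both upper bounds, which differ only in `P`: remove the two ends of
    -- an edge inside `xs` until none is left, and then bound the rest by all pairs between `xs` and
    -- `ys`.
    touching-elim : (P : ℕ → ℕ → Set) →
      (∀ {n t} → t ≤ n * length ys → P n t) →
      (∀ {n s t} → t ≤ 1 + n + length ys + s → P n s → P (2 + n) t) →
      ∀ xs → P (length xs) (touching xs)
    touching-elim P base step xs = go (length xs) xs ≤-refl
      where
      -- The recursion is on a bound `k` for the length, since `zs` is a tail of `xs` only up to
      -- permutation.
      go : ∀ k xs → length xs ≤ k → P (length xs) (touching xs)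
      go k xs ≤k with edge-or-independent xs
      ... | inj₁ eq = base (≤-trans
              (≤-reflexive (cong (_+ between G xs ys) eq))
              (∑-≤ xs (λ x → ≤-trans (∑-≤ ys (λ y → 𝟙≤1 (adj? G x y))) (≤-reflexive (*-identityʳ _)))))
      go k xs ≤k | inj₂ (a , b , zs , a~b , p) with k | ≤-trans (≤-reflexive (sym (↭-length p))) ≤k
      ... | suc k | s≤s sz≤k
        rewrite ↭-length p | induced-↭ G p | ∑-↭ (degree G ys) p
        = step (remove-edge zs a~b) (go k zs (≤-trans (n≤1+n _) sz≤k))

    -- Two removed vertices cost at most 1 + n + m edges, which is at most 2m while 2 + n ≤ m. The
    -- size condition sits inside the motive because it must pass to the shorter list.
    touching≤product : ∀ xs → length xs ≤ length ys → touching xs ≤ length xs * length ys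
    touching≤product = touching-elim (λ n t → n ≤ m → t ≤ n * m) (λ t≤ _ → t≤) step
      where
      m = length ys
      step : ∀ {n s t} → t ≤ 1 + n + m + s → (n ≤ m → s ≤ n * m) → 2 + n ≤ m → t ≤ (2 + n) * m
      step {n} {s} {t} t≤ ih n+2≤m = begin
        t                    ≤⟨ t≤ ⟩
        1 + n + m + s        ≤⟨ +-mono-≤ (+-monoˡ-≤ m n+1≤m) (ih (≤-trans (n≤1+n n) n+1≤m)) ⟩
        m + m + n * m        ≡⟨ +-assoc m m (n * m) ⟩
        (2 + n) * m          ∎
        where
        open ≤-Reasoning
        n+1≤m = ≤-trans (n≤1+n _) n+2≤m

    -- Mantel's bound, multiplied by 4 to avoid division: raising n by 2 raises (n + m)² by exactly
    -- 4 (1 + n + m), four times the cost of one removal.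
    4*touching≤square : ∀ xs →
      4 * touching xs ≤ (length xs + length ys) * (length xs + length ys)
    4*touching≤square = touching-elim (λ n t → 4 * t ≤ (n + m) * (n + m)) (λ {n} → base {n}) step
      where
      open ≤-Reasoning
      m = length ys
      -- The inequality of arithmetic and geometric means; the two sides differ by the square of the
      -- difference `d`.
      4nm≤ : ∀ n m → 4 * (n * m) ≤ (n + m) * (n + m)
      4nm≤ n m with ≤-total n m
      ... | inj₁ n≤m with d , refl ← m≤n⇒∃[o]m+o≡n n≤m =
        ≤-trans (m≤m+n _ (d * d)) (≤-reflexive (eq n d))
        where
        eq : ∀ n d → 4 * (n * (n + d)) + d * d ≡ (n + (n + d)) * (n + (n + d))
        eq = solve-∀
      ... | inj₂ m≤n with d , refl ← m≤n⇒∃[o]m+o≡n m≤n =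
        ≤-trans (m≤m+n _ (d * d)) (≤-reflexive (eq m d))
        where
        eq : ∀ m d → 4 * ((m + d) * m) + d * d ≡ ((m + d) + m) * ((m + d) + m)
        eq = solve-∀
      base : ∀ {n t} → t ≤ n * m → 4 * t ≤ (n + m) * (n + m)
      base {n} t≤ = ≤-trans (*-monoʳ-≤ 4 t≤) (4nm≤ n m)
      step : ∀ {n s t} → t ≤ 1 + n + m + s → 4 * s ≤ (n + m) * (n + m) →
        4 * t ≤ (2 + n + m) * (2 + n + m)
      step {n} {s} {t} t≤ ih = begin
        4 * t                               ≤⟨ *-monoʳ-≤ 4 t≤ ⟩
        4 * (1 + n + m + s)                 ≡⟨ *-distribˡ-+ 4 (1 + n + m) s ⟩
        4 * (1 + n + m) + 4 * s             ≤⟨ +-monoʳ-≤ (4 * (1 + n + m)) ih ⟩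
        4 * (1 + n + m) + (n + m) * (n + m) ≡⟨ eq n m ⟩
        (2 + n + m) * (2 + n + m)           ∎
        where
        eq : ∀ n m → 4 * (1 + n + m) + (n + m) * (n + m) ≡ (2 + n + m) * (2 + n + m)
        eq = solve-∀

-- The total n + m of a + b + m vertices is split as evenly as possible into a + m and b.
NearlyEven : ℕ → ℕ → ℕ → Set
NearlyEven a b m = ∃[ e ] e ≤ 1 × 4 * (b * (a + m)) + e ≡ (a + b + m) * (a + b + m)

-- The sizes a and b of the two parts of the clique in a maximum cut; the independent vertices
-- are on the side of the first part.
data OptimalCut (a b m : ℕ) : Set where
  small    : a ≡ 0 → b ≤ m → OptimalCut a b m
  balanced : NearlyEven a b m → OptimalCut a b m

-- In the nearly even case, four times the count is at most 4c + e with e ≤ 1, hence below 4 (c +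
-- 1), where c is the size of the cut. Integrality then gives the bound c.
touching≤cut : ∀ {a b m} → OptimalCut a b m → (G : Graph N) (tf : TriangleFree G) → ∀ xs ys →
  length xs ≡ a + b → length ys ≡ m → Mantel.touching G tf ys xs ≤ b * (a + m)
touching≤cut (small refl b≤m) G tf xs ys refl refl = Mantel.touching≤product G tf ys xs b≤m
touching≤cut {a = a} {b} {m} (balanced (e , e≤1 , cut)) G tf xs ys ∣xs∣ refl =
  s≤s⁻¹ (*-cancelˡ-< 4 _ _ (begin-strict
    4 * Mantel.touching G tf ys xs      ≤⟨ Mantel.4*touching≤square G tf ys xs ⟩
    (length xs + m) * (length xs + m)   ≡⟨ cong (λ n → (n + m) * (n + m)) ∣xs∣ ⟩
    (a + b + m) * (a + b + m)           ≡⟨ cut ⟨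
    4 * (b * (a + m)) + e               ≤⟨ +-monoʳ-≤ (4 * (b * (a + m))) e≤1 ⟩
    4 * (b * (a + m)) + 1               <⟨ +-monoʳ-< (4 * (b * (a + m))) (s≤s (s≤s z≤n)) ⟩
    4 * (b * (a + m)) + 4               ≡⟨ +-comm (4 * (b * (a + m))) 4 ⟩
    4 + 4 * (b * (a + m))               ≡⟨ *-suc 4 (b * (a + m)) ⟨
    4 * suc (b * (a + m))               ∎))
  where open ≤-Reasoning

-- Balance

-- A triangle has three negative edges, so its sign is negative.
balanced⇒triangleFree : (G H : Graph N) → Balanced ((- G) ∖ H) → TriangleFree (G ∖ᴳ H)
balanced⇒triangleFree G H bal {a} {b} {c} ab ac bc with bal triangle
  where
  D = G ∖ᴳ H
  distinct⇐ : ∀ {u v} → Adj D u v → u ≢ v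
  distinct⇐ e u≡v = irrefl D u≡v e
  triangle : Cycle D
  triangle = record
    { path     = ab ◅ bc ◅ ε
    ; distinct = (distinct⇐ ab ∷ distinct⇐ ac ∷ []) ∷ (distinct⇐ bc ∷ []) ∷ [] ∷ []
    ; long     = s≤s (s≤s (s≤s z≤n))
    ; closing  = symm D ac
    }
... | ()

-- The easy direction of Harary's balance theorem. Along a walk the inner factors `s w` occur twice
-- and cancel, so its sign depends only on its ends; closing the walk cancels these too.
switching⇒balanced : (Σ : SignedGraph N) (s : Fin N → Sign) →
  (∀ {u v} (e : Adj (graph Σ) u v) → σ Σ e ≡ s u Sign.* s v) → Balanced Σ
switching⇒balanced Σ s σ≡ C = begin
  cycleSign Σ C ≡⟨ cong₂ Sign._*_ (walkSign≡ path) (σ≡ closing) ⟩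
  (s start Sign.* s end) Sign.* (s end Sign.* s start) ≡⟨ cong (Sign._* (s end Sign.* s start)) (Sign.*-comm (s start) (s end)) ⟩
  (s end Sign.* s start) Sign.* (s end Sign.* s start) ≡⟨ Sign.s*s≡+ (s end Sign.* s start) ⟩
  Sign.+ ∎
  where
  open ≡-Reasoning
  open Cycle C
  cancel : ∀ x y z → (x Sign.* y) Sign.* (y Sign.* z) ≡ x Sign.* z
  cancel x y z = begin
    (x Sign.* y) Sign.* (y Sign.* z) ≡⟨ Sign.*-assoc x y (y Sign.* z) ⟩
    x Sign.* (y Sign.* (y Sign.* z)) ≡⟨ cong (x Sign.*_) (Sign.*-assoc y y z) ⟨
    x Sign.* ((y Sign.* y) Sign.* z) ≡⟨ cong (λ t → x Sign.* (t Sign.* z)) (Sign.s*s≡+ y) ⟩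
    x Sign.* z ∎
  walkSign≡ : ∀ {u v} (p : Walk (graph Σ) u v) → walkSign Σ p ≡ s u Sign.* s v
  walkSign≡ {u} ε = sym (Sign.s*s≡+ (s u))
  walkSign≡ {u} {v} (_◅_ {j = w} e p) =
    trans (cong₂ Sign._*_ (σ≡ e) (walkSign≡ p)) (cancel (s u) (s w) (s v))

-- The edges inside the two classes of the bipartition `s`; deleting them leaves the cut.
monochromatic : Graph N → (Fin N → Sign) → Graph N
Adj    (monochromatic G s) u v = Adj G u v × s u ≡ s v
symm   (monochromatic G s) (e , eq) = symm G e , sym eq
irrefl (monochromatic G s) eq (e , _) = irrefl G eq e
adj?   (monochromatic G s) u v = adj? G u v ×-dec (s u Sign.≟ s v)

monochromatic-balances : (G : Graph N) (s : Fin N → Sign) → Balanced ((- G) ∖ monochromatic G s)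
monochromatic-balances G s = switching⇒balanced ((- G) ∖ monochromatic G s) s
  λ { (e , ¬mono) → opposite (λ eq → ¬mono (e , eq)) }
  where
  opposite : ∀ {x y} → x ≢ y → Sign.- ≡ x Sign.* y
  opposite {Sign.+} {Sign.+} x≢y = contradiction refl x≢y
  opposite {Sign.+} {Sign.-} x≢y = refl
  opposite {Sign.-} {Sign.+} x≢y = refl
  opposite {Sign.-} {Sign.-} x≢y = contradiction refl x≢y

-- The complete split graph

module _ (n m : ℕ) where

  private
    S = completeSplit n m

  clique : List (Fin (n + m))
  clique = tabulate (_↑ˡ m)

  independent : List (Fin (n + m))
  independent = tabulate (n ↑ʳ_)

  clique-adj : ∀ {i j} → i ≢ j → Adj S (i ↑ˡ m) (j ↑ˡ m)
  clique-adj {i} {j} i≢j rewrite Fin.splitAt-↑ˡ n i m | Fin.splitAt-↑ˡ n j m = i≢j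

  cross-adj : ∀ i j → Adj S (i ↑ˡ m) (n ↑ʳ j)
  cross-adj i j rewrite Fin.splitAt-↑ˡ n i m | Fin.splitAt-↑ʳ n m j = _

  independent-¬adj : ∀ i j → ¬ Adj S (n ↑ʳ i) (n ↑ʳ j)
  independent-¬adj i j rewrite Fin.splitAt-↑ʳ n m i | Fin.splitAt-↑ʳ n m j = id

  -- No edge joins two independent vertices. The right side is `touching` unfolded, so Mantel's
  -- bounds apply to it directly.
  ∣E∣-split : (G : Graph (n + m)) → G ⊆ᴱ S →
    ∣E G ∣ ≡ induced G clique + between G clique independent
  ∣E∣-split G G⊆S = begin
    ∣E G ∣                                           ≡⟨ ∣E∣≡induced G ⟩
    induced G (allFin (n + m))                       ≡⟨ cong (induced G) (tabulate-+ n id) ⟩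
    induced G (clique ++ independent)                ≡⟨ induced-++ G clique independent ⟩
    induced G clique + between G clique independent + induced G independent
      ≡⟨ cong (λ k → induced G clique + between G clique independent + k)
           (induced-independent G (tabulate⁺ λ {i} {j} _ → independent-¬adj i j ∘ G⊆S)) ⟩
    induced G clique + between G clique independent + 0 ≡⟨ +-identityʳ _ ⟩
    induced G clique + between G clique independent  ∎
    where open ≡-Reasoning

  ∣E∣-completeSplit : 2 * ∣E S ∣ + n ≡ n * n + 2 * (n * m)
  ∣E∣-completeSplit = begin
    2 * ∣E S ∣ + n                             ≡⟨ cong (λ k → 2 * k + n) (∣E∣-split S id) ⟩
    2 * (e + between S clique independent) + n
      ≡⟨ cong (λ k → 2 * (e + k) + n) (between-full S (_↑ˡ m) (n ↑ʳ_) cross-adj) ⟩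
    2 * (e + n * m) + n                        ≡⟨ rearrange e (n * m) n ⟩
    2 * e + n + 2 * (n * m)
      ≡⟨ cong (_+ 2 * (n * m)) (subst (λ k → 2 * e + k ≡ k * k) (length-tabulate (_↑ˡ m))
           (induced-clique S (tabulate⁺ clique-adj))) ⟩
    n * n + 2 * (n * m)                        ∎
    where
    open ≡-Reasoning
    e = induced S clique
    rearrange : ∀ e c n → 2 * (e + c) + n ≡ 2 * e + n + 2 * c
    rearrange = solve-∀

module _ (a b m : ℕ) where

  private
    S = completeSplit (a + b) m

  side : Fin (a + b + m) → Sign
  side u = [ [ const Sign.+ , const Sign.- ]′ ∘ splitAt a , const Sign.+ ]′ (splitAt (a + b) u)

  private
    H = monochromatic S side

    nearPart : Fin a → Fin (a + b + m)
    nearPart i = (i ↑ˡ b) ↑ˡ m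

    farPart : Fin b → Fin (a + b + m)
    farPart i = (a ↑ʳ i) ↑ˡ m

    side-near : ∀ i → side (nearPart i) ≡ Sign.+
    side-near i rewrite Fin.splitAt-↑ˡ (a + b) (i ↑ˡ b) m | Fin.splitAt-↑ˡ a i b = refl

    side-far : ∀ i → side (farPart i) ≡ Sign.-
    side-far i rewrite Fin.splitAt-↑ˡ (a + b) (a ↑ʳ i) m | Fin.splitAt-↑ʳ a b i = refl

    side-independent : ∀ i → side ((a + b) ↑ʳ i) ≡ Sign.+
    side-independent i rewrite Fin.splitAt-↑ʳ (a + b) m i = refl

    same : ∀ {u v x} → side u ≡ x → side v ≡ x → ¬ Adj (S ∖ᴳ H) u v
    same p q (e , ¬mono) = ¬mono (e , trans p (sym q))

    different : ∀ {u v x y} → x ≢ y → Adj S u v → side u ≡ x → side v ≡ y → Adj (S ∖ᴳ H) u v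
    different x≢y e p q = e , λ (_ , eq) → x≢y (trans (sym p) (trans eq q))

  -- Of the pairs of blocks, only near with far and far with independent lie across the cut, and
  -- there every edge is present.
  ∣E∣-cut : ∣E S ∖ᴳ H ∣ ≡ b * (a + m)
  ∣E∣-cut = begin
    ∣E D ∣ ≡⟨ ∣E∣-split (a + b) m D proj₁ ⟩
    induced D (clique (a + b) m) + between D (clique (a + b) m) ind
      ≡⟨ cong (λ xs → induced D xs + between D xs ind) (tabulate-+ a (_↑ˡ m)) ⟩
    induced D (near ++ far) + between D (near ++ far) ind
      ≡⟨ cong₂ _+_ (induced-++ D near far) (between-++ˡ D near far ind) ⟩
    induced D near + between D near far + induced D far + (between D near ind + between D far ind)
      ≡⟨ cong₂ _+_
           (cong₂ _+_ (cong₂ _+_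
              (induced-independent D (tabulate⁺ λ {i} {j} _ → same (side-near i) (side-near j)))
              (between-full D nearPart farPart λ i j →
                different (λ ()) (clique-adj (a + b) m (i↑ˡ≢j↑ʳ i j)) (side-near i) (side-far j)))
              (induced-independent D (tabulate⁺ λ {i} {j} _ → same (side-far i) (side-far j))))
           (cong₂ _+_
              (between-none D nearPart ((a + b) ↑ʳ_) λ i j → same (side-near i) (side-independent j))
              (between-full D farPart ((a + b) ↑ʳ_) λ i j →
                different (λ ()) (cross-adj (a + b) m (a ↑ʳ i) j) (side-far i) (side-independent j))) ⟩
    0 + a * b + 0 + (0 + b * m) ≡⟨ rearrange a b m ⟩
    b * (a + m) ∎
    where
    open ≡-Reasoning
    D = S ∖ᴳ H
    near = tabulate nearPart
    far = tabulate farPart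
    ind = independent (a + b) m
    i↑ˡ≢j↑ʳ : ∀ (i : Fin a) (j : Fin b) → i ↑ˡ b ≢ a ↑ʳ j
    i↑ˡ≢j↑ʳ i j eq
      with () ← trans (sym (Fin.splitAt-↑ˡ a i b)) (trans (cong (splitAt a) eq) (Fin.splitAt-↑ʳ a b j))
    rearrange : ∀ a b m → 0 + a * b + 0 + (0 + b * m) ≡ b * (a + m)
    rearrange = solve-∀

  isFrustrationIndex : OptimalCut a b m → IsFrustrationIndex (- S) ∣E H ∣
  isFrustrationIndex opt = (H , proj₁ , monochromatic-balances S side , refl) , minimal
    where
    open ≤-Reasoning
    minimal : ∀ H′ → H′ ⊆ᴱ S → Balanced ((- S) ∖ H′) → ∣E H ∣ ≤ ∣E H′ ∣
    -- Both deletions start from the same edges of `S`. Adding the size of the cut turns the claim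
    -- into the upper bound on the edges kept by `H′`.
    minimal H′ H′⊆S bal = +-cancelʳ-≤ (b * (a + m)) _ _ (begin
      ∣E H ∣ + b * (a + m)       ≡⟨ cong (λ k → ∣E H ∣ + k) ∣E∣-cut ⟨
      ∣E H ∣ + ∣E S ∖ᴳ H ∣       ≡⟨ ∣E∣-∖ᴳ S H proj₁ ⟨
      ∣E S ∣                     ≡⟨ ∣E∣-∖ᴳ S H′ H′⊆S ⟩
      ∣E H′ ∣ + ∣E S ∖ᴳ H′ ∣     ≡⟨ cong (λ k → ∣E H′ ∣ + k) (∣E∣-split (a + b) m (S ∖ᴳ H′) proj₁) ⟩
      ∣E H′ ∣ + _                ≤⟨ +-monoʳ-≤ ∣E H′ ∣
        (touching≤cut opt (S ∖ᴳ H′) (balanced⇒triangleFree S H′ bal)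
          (clique (a + b) m) (independent (a + b) m) (length-tabulate _) (length-tabulate _)) ⟩
      ∣E H′ ∣ + b * (a + m)      ∎)

  -- Determines the frustration index from the size of the cut, in a form free of halving and
  -- subtraction; both cases of the formula are read off from it.
  ∣E∣-monochromatic :
    2 * ∣E H ∣ + 2 * (b * (a + m)) + (a + b) ≡ (a + b) * (a + b) + 2 * ((a + b) * m)
  ∣E∣-monochromatic = begin
    2 * ∣E H ∣ + 2 * (b * (a + m)) + (a + b)
      ≡⟨ cong (_+ (a + b)) (*-distribˡ-+ 2 ∣E H ∣ (b * (a + m))) ⟨
    2 * (∣E H ∣ + b * (a + m)) + (a + b)
      ≡⟨ cong (λ k → 2 * (∣E H ∣ + k) + (a + b)) ∣E∣-cut ⟨
    2 * (∣E H ∣ + ∣E S ∖ᴳ H ∣) + (a + b)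
      ≡⟨ cong (λ k → 2 * k + (a + b)) (∣E∣-∖ᴳ S H proj₁) ⟨
    2 * ∣E S ∣ + (a + b)
      ≡⟨ ∣E∣-completeSplit (a + b) m ⟩
    (a + b) * (a + b) + 2 * ((a + b) * m) ∎
    where open ≡-Reasoning

-- Choice of the cut and evaluation of the formula

balancedCut : ∀ {n m} → n > m → ∃[ a ] ∃[ b ] n ≡ a + b × NearlyEven a b m
balancedCut {n} {m} n>m with d , refl ← m≤n⇒∃[o]m+o≡n (<⇒≤ n>m) = halve 0 d
  where
  even : ∀ a m → 4 * ((a + m) * (a + m)) + 0 ≡ (a + (a + m) + m) * (a + (a + m) + m)
  even = solve-∀
  odd : ∀ a m → 4 * ((a + m) * (suc a + m)) + 1 ≡ (suc a + (a + m) + m) * (suc a + (a + m) + m)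
  odd = solve-∀
  evenSize : ∀ a m → m + (a + a + 0) ≡ a + (a + m)
  evenSize = solve-∀
  oddSize : ∀ a m → m + (a + a + 1) ≡ suc a + (a + m)
  oddSize = solve-∀
  next : ∀ a d → a + a + suc (suc d) ≡ suc a + suc a + d
  next = solve-∀
  -- Two units of the excess n - m pass to one unit of `a` at a time. The remaining 0 or 1 is the
  -- parity of n - m, and hence the defect `e`.
  halve : ∀ a d → ∃[ a′ ] ∃[ b ] m + (a + a + d) ≡ a′ + b × NearlyEven a′ b m
  halve a zero          = a , a + m , evenSize a m , 0 , z≤n , even a m
  halve a (suc zero)    = suc a , a + m , oddSize a m , 1 , ≤-refl , odd a m
  halve a (suc (suc d)) rewrite next a d = halve (suc a) d

-- Sums in ℚᵘ are not reduced: adding the denominators 4, 2, 4 gives 4 * 2 * 4 = 32.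
floor≡ : ∀ k m l {r} → r < 32 →
  (k * k * 2 + m * suc k * 4) * 4 ≡ 8 * (m * m) + (r + l * 32) →
  floor (((+ k) ℤ.^ 2) / 4 ℚ.+ (+ m ℤ.* + suc k) / 2 ℚ.- ((+ m) ℤ.^ 2) / 4) ≡ + l
floor≡ k m l {r} r<32 eq = begin
  -- Integer division unfolds to the sign of the divisor, here 1, times division by its absolute
  -- value.
  1ℤ ℤ.* (numerator ℤ./ℕ 32)       ≡⟨ ℤ.*-identityˡ _ ⟩
  numerator ℤ./ℕ 32                ≡⟨ cong (ℤ._/ℕ 32) numerator≡ ⟩
  + ((r + l * 32) ℕ./ 32)          ≡⟨ cong +_ (ℕ.+-distrib-/-∣ʳ r (divides-refl l)) ⟩
  + (r ℕ./ 32 + l * 32 ℕ./ 32)     ≡⟨ cong₂ (λ x y → + (x + y)) (ℕ.m<n⇒m/n≡0 r<32) (ℕ.m*n/n≡m l 32) ⟩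
  + l                              ∎
  where
  open ≡-Reasoning
  numerator = (((+ k) ℤ.^ 2) ℤ.* + 2 ℤ.+ (+ m ℤ.* + suc k) ℤ.* + 4) ℤ.* + 4
            ℤ.+ (ℤ.- ((+ m) ℤ.^ 2)) ℤ.* + 8
  rearrange : ∀ K M N → ((K ℤ.* (K ℤ.* 1ℤ)) ℤ.* + 2 ℤ.+ (M ℤ.* N) ℤ.* + 4) ℤ.* + 4
      ℤ.+ (ℤ.- (M ℤ.* (M ℤ.* 1ℤ))) ℤ.* + 8
    ≡ (K ℤ.* K ℤ.* + 2 ℤ.+ M ℤ.* N ℤ.* + 4) ℤ.* + 4 ℤ.- + 8 ℤ.* (M ℤ.* M)
  rearrange = ℤSolver.solve-∀
  cancel : ∀ x y → x ℤ.+ y ℤ.- x ≡ y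
  cancel = ℤSolver.solve-∀
  pos : + ((k * k * 2 + m * suc k * 4) * 4) ≡
    (+ k ℤ.* + k ℤ.* + 2 ℤ.+ + m ℤ.* + suc k ℤ.* + 4) ℤ.* + 4
  pos = trans (ℤ.pos-* (k * k * 2 + m * suc k * 4) 4) (cong (ℤ._* + 4) (cong₂ ℤ._+_
    (trans (ℤ.pos-* (k * k) 2) (cong (ℤ._* + 2) (ℤ.pos-* k k)))
    (trans (ℤ.pos-* (m * suc k) 4) (cong (ℤ._* + 4) (ℤ.pos-* m (suc k))))))
  numerator≡ : numerator ≡ + (r + l * 32)
  numerator≡ = begin
    numerator
      ≡⟨ rearrange (+ k) (+ m) (+ suc k) ⟩
    (+ k ℤ.* + k ℤ.* + 2 ℤ.+ + m ℤ.* + suc k ℤ.* + 4) ℤ.* + 4 ℤ.- + 8 ℤ.* (+ m ℤ.* + m)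
      ≡⟨ cong₂ ℤ._-_ pos (trans (ℤ.pos-* 8 (m * m)) (cong (+ 8 ℤ.*_) (ℤ.pos-* m m))) ⟨
    + ((k * k * 2 + m * suc k * 4) * 4) ℤ.- + (8 * (m * m))
      ≡⟨ cong (λ x → + x ℤ.- + (8 * (m * m))) eq ⟩
    + (8 * (m * m)) ℤ.+ + (r + l * 32) ℤ.- + (8 * (m * m))
      ≡⟨ cancel (+ (8 * (m * m))) (+ (r + l * 32)) ⟩
    + (r + l * 32) ∎

-- Here c is the size of the cut, and e = (n + m)² - 4 c is 0 or 1 according to parity.
cutValue : ∀ k m l c e {r} → 4 * c + e ≡ (suc k + m) * (suc k + m) → r + 8 * e ≡ 8 →
  2 * l + 2 * c + suc k ≡ suc k * suc k + 2 * (suc k * m) →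
  (k * k * 2 + m * suc k * 4) * 4 ≡ 8 * (m * m) + (r + l * 32)
-- The added terms complete both sides so that `cut`, `re` and `value` can be substituted as whole
-- expressions.
cutValue k m l c e {r} cut re value = +-cancelʳ-≡ (16 * suc k + 32 * c + 8 * e) _ _ (begin
  (k * k * 2 + m * suc k * 4) * 4 + (16 * suc k + 32 * c + 8 * e)
    ≡⟨ left k m c e ⟩
  8 * (suc k * suc k) + 8 + 16 * (m * suc k) + 8 * (4 * c + e)
    ≡⟨ cong (λ t → 8 * (suc k * suc k) + 8 + 16 * (m * suc k) + 8 * t) cut ⟩
  8 * (suc k * suc k) + 8 + 16 * (m * suc k) + 8 * ((suc k + m) * (suc k + m))
    ≡⟨ middle (suc k) m ⟩
  8 * (m * m) + 8 + 16 * (suc k * suc k + 2 * (suc k * m))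
    ≡⟨ cong₂ (λ s t → 8 * (m * m) + s + 16 * t) re value ⟨
  8 * (m * m) + (r + 8 * e) + 16 * (2 * l + 2 * c + suc k)
    ≡⟨ right (m * m) r e l c (suc k) ⟩
  8 * (m * m) + (r + l * 32) + (16 * suc k + 32 * c + 8 * e) ∎)
  where
  open ≡-Reasoning
  left : ∀ k m c e → (k * k * 2 + m * suc k * 4) * 4 + (16 * suc k + 32 * c + 8 * e)
    ≡ 8 * (suc k * suc k) + 8 + 16 * (m * suc k) + 8 * (4 * c + e)
  left = solve-∀
  middle : ∀ n m → 8 * (n * n) + 8 + 16 * (m * n) + 8 * ((n + m) * (n + m))
    ≡ 8 * (m * m) + 8 + 16 * (n * n + 2 * (n * m))
  middle = solve-∀
  right : ∀ q r e l c n → 8 * q + (r + 8 * e) + 16 * (2 * l + 2 * c + n)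
    ≡ 8 * q + (r + l * 32) + (16 * n + 32 * c + 8 * e)
  right = solve-∀

lemma27 : ∀ (n m : ℕ) → 1 ≤ n → 1 ≤ m →
    ∃[ l ] IsFrustrationIndex (- completeSplit n m) l
    × (n > m → + l ≡ floor (((+ n ℤ.- 1ℤ) ℤ.^ 2) / 4 ℚ.+ (+ m ℤ.* + n) / 2 ℚ.- ((+ m) ℤ.^ 2) / 4))
    × (n ≤ m → (+ l) / 1 ≃ (+ n ℤ.* (+ n ℤ.- 1ℤ)) / 2)
lemma27 n@(suc k) m _ _ with ≤-<-connex n m
... | inj₁ n≤m =
  -- The whole clique lies opposite the independent vertices, so the deleted edges are the n(n -
  -- 1)/2 edges of the clique.
  l , isFrustrationIndex 0 n m (small refl n≤m) , (λ n>m → contradiction n≤m (<⇒≱ n>m)) ,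
  λ _ → *≡* (begin
    + l ℤ.* + 2         ≡⟨ ℤ.pos-* l 2 ⟨
    + (l * 2)           ≡⟨ cong +_ (+-cancelʳ-≡ (2 * (n * m) + n) _ _ (begin
      l * 2 + (2 * (n * m) + n)   ≡⟨ regroup l (n * m) n ⟩
      2 * l + 2 * (n * m) + n     ≡⟨ ∣E∣-monochromatic 0 n m ⟩
      n * n + 2 * (n * m)         ≡⟨ square k (n * m) ⟩
      n * k + (2 * (n * m) + n)   ∎)) ⟩
    + (n * k)           ≡⟨ ℤ.pos-* n k ⟩
    + n ℤ.* + k         ≡⟨ ℤ.*-identityʳ _ ⟨
    + n ℤ.* + k ℤ.* 1ℤ  ∎)
  where
  open ≡-Reasoning
  l = ∣E monochromatic (completeSplit n m) (side 0 n m) ∣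
  regroup : ∀ l p n → l * 2 + (2 * p + n) ≡ 2 * l + 2 * p + n
  regroup = solve-∀
  square : ∀ k p → suc k * suc k + 2 * p ≡ suc k * k + (2 * p + suc k)
  square = solve-∀
... | inj₂ n>m with a , b , n≡ , e , e≤1 , cut ← balancedCut n>m =
  l , subst (λ n → IsFrustrationIndex (- completeSplit n m) l) (sym n≡)
        (isFrustrationIndex a b m (balanced (e , e≤1 , cut))) ,
  -- The remainder is 8 - 8e out of 32: the expression under the floor exceeds `l` by 1/4 if n + m
  -- is even and by 0 if it is odd.
  (λ _ → sym (floor≡ k m l (≤-<-trans (m∸n≤m 8 (8 * e)) (<ᵇ⇒< 8 32 _))
    (cutValue k m l (b * (a + m)) e (trans cut (cong (λ n → (n + m) * (n + m)) (sym n≡)))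
      (m∸n+n≡m (*-monoʳ-≤ 8 e≤1))
      (subst (λ n → 2 * l + 2 * (b * (a + m)) + n ≡ n * n + 2 * (n * m)) (sym n≡)
        (∣E∣-monochromatic a b m))))) ,
  λ n≤m → contradiction n≤m (<⇒≱ n>m)
  where
  l = ∣E monochromatic (completeSplit (a + b) m) (side a b m) ∣
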